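{- If $p$ is a prime number, then $J_{p-1}=2$; that is, the only $(\delta_0,\ldots,\delta_{p-1})\in\{ -1,1\}^{p}$ with $\sum_{i=0}^{p-1}\delta_i\binom{p-1}{i}=0$ are $\delta_i=(-1)^i$ for all $i$ and $\delta_i=-(-1)^i$ for all $i$.
   Context: For a positive integer $n$, $J_n$ denotes the number of sign vectors $(\delta_0,\ldots,\delta_n)\in\{ -1,1\}^{n+1}$ such that $\sum_{i=0}^{n}\delta_i\binom{n}{i}=0$. -}

module Defs where

open import Data.Nat using (ℕ; zero; suc)
open import Data.Nat.Combinatorics using (_C_)
open import Data.Integer using (ℤ; _◃_; _+_; 0ℤ)
open import Data.Sign using (Sign; opposite)
open import Data.Fin using (Fin; toℕ)
open import Data.Vec using (Vec; []; _∷_; lookup)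
open import Data.List using (List; []; _∷_; map; concatMap; length; filter)
open import Relation.Binary.PropositionalEquality using (_≡_)
import Data.Integer.Properties as ℤP
open import Data.Bool using (Bool; true; false)

-- A sign vector δ = (δ_0, …, δ_n) ∈ {-1,1}^{n+1}, with Sign.+ ≙ 1, Sign.- ≙ -1.
SignVec : ℕ → Set
SignVec n = Vec Sign (suc n)

-- Σ_{i=0}^{n} δ_i * binom(n, i), computed as an integer.
-- The helper sums over the entries of a length-m vector, offset by index k.
signedSumFrom : (n k : ℕ) {m : ℕ} → Vec Sign m → ℤ
signedSumFrom n k []       = 0ℤ
signedSumFrom n k (s ∷ δ) = (s ◃ (n C k)) + signedSumFrom n (suc k) δ

signedBinomSum : (n : ℕ) → SignVec n → ℤ
signedBinomSum n δ = signedSumFrom n 0 δ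

-- Exhaustive list of all sign vectors of length m (2^m of them, each exactly once).
allSignVecs : (m : ℕ) → List (Vec Sign m)
allSignVecs zero    = [] ∷ []
allSignVecs (suc m) =
  concatMap (λ v → (Sign.+ ∷ v) ∷ (Sign.- ∷ v) ∷ []) (allSignVecs m)

-- J_n = #{ δ ∈ {-1,1}^{n+1} : Σ δ_i binom(n,i) = 0 }.
J : ℕ → ℕ
J n = length (filter (λ δ → signedBinomSum n δ ℤP.≟ 0ℤ) (allSignVecs (suc n)))

-- (-1)^i as a sign.
altSign : ℕ → Sign
altSign zero    = Sign.+
altSign (suc i) = opposite (altSign i)

-- Write p = n + 1. As p divides C(p, k) for 0 < k < p, Pascal's rule gives C(n, i) ≡ (-1)^i (mod p), so
-- for δ ∈ {±1}^p we get Σ δ_i C(n, i) ≡ Σ δ_i (-1)^i = p - 2H (mod p), where H is the Hamming distance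
-- from δ to the alternating vector ((-1)^i)_i, i.e. 'iterate opposite + p'. A vanishing sum forces p ∣ 2H
-- with H ≤ p, hence for odd p either H = 0 or H = p: δ = ±((-1)^i)_i (p = 2 is checked by hand).
-- Conversely the alternating sums telescope to 0 by Pascal's rule, and since allSignVecs lists every
-- sign vector exactly once, J (p - 1) = 2.
module Submission where

open import Defs
open import Data.Bool using (true; false; if_then_else_)
open import Data.Fin using (Fin; zero; suc; toℕ)
open import Data.Integer as ℤ using (ℤ; +_; -_; _+_; _-_; _◃_; 0ℤ; 1ℤ)
import Data.Integer.Properties as ℤ
open import Data.Integer.Divisibility.Signed as ℤ∣ using (∣ᵤ⇒∣; ∣⇒∣ᵤ)
import Data.Integer.Tactic.RingSolver as ℤ-Solver
open import Data.List using (List; []; _∷_; length; filter; concatMap)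
open import Data.List.Properties using (filter-accept; filter-reject; filter-≐; filter-none)
import Data.List.Relation.Unary.All as All
open import Data.Nat as ℕ using (ℕ; zero; suc; _∸_; _≤_; _<_; s≤s; z≤n)
open import Data.Nat.Combinatorics using (_C_; nC1≡n; k>n⇒nCk≡0; nCk+nC[k+1]≡[n+1]C[k+1])
open import Data.Nat.Divisibility using (_∣_; divides; ∣⇒≤)
open import Data.Nat.Primality using (Prime; euclidsLemma)
open import Data.Nat.Properties
  using ( *-comm; *-zeroʳ; *-identityʳ; +-identityʳ; *-distribˡ-+; +-suc; suc-injective
        ; ≤-refl; ≤-reflexive; ≤-antisym; ≤-pred; <⇒≤; <⇒≱; <⇒≢
        ; m≤n⇒m≤1+n; m+n≤o⇒m≤o )
open import Data.Nat.Tactic.RingSolver using (solve-∀)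
open import Data.Product using (_×_; _,_)
open import Data.Sign as Sign using (Sign; opposite)
import Data.Sign.Properties as Sign
open import Data.Sum using (_⊎_; inj₁; inj₂; [_,_])
open import Data.Sum.Function.Propositional using (_⊎-⇔_)
open import Data.Vec using (Vec; []; _∷_; map; iterate; lookup)
open import Data.Vec.Properties using (≡-dec; ∷-injectiveˡ; ∷-injectiveʳ; tabulate∘lookup; tabulate-cong)
open import Function using (_∘_)
open import Function.Bundles using (_⇔_; mk⇔; Equivalence)
open import Function.Construct.Composition using (_⇔-∘_)
open import Relation.Binary.Definitions using (DecidableEquality)
open import Relation.Binary.PropositionalEquality
  using (_≡_; _≢_; refl; sym; trans; cong; cong₂; subst; subst₂; module ≡-Reasoning)
import Relation.Binary.Reasoning.Base.Single as SingleRelationReasoning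
open import Relation.Nullary using (¬_; contradiction; yes; no; does)
open import Relation.Unary using (Pred; Decidable)

[k+1]*[n+1]C[k+1]≡[n+1]*nCk : ∀ n k → suc k ℕ.* (suc n C suc k) ≡ suc n ℕ.* (n C k)
[k+1]*[n+1]C[k+1]≡[n+1]*nCk zero zero = refl
[k+1]*[n+1]C[k+1]≡[n+1]*nCk zero (suc k)
  rewrite k>n⇒nCk≡0 {1} {suc (suc k)} (s≤s (s≤s z≤n)) | k>n⇒nCk≡0 {0} {suc k} (s≤s z≤n) = *-zeroʳ k
[k+1]*[n+1]C[k+1]≡[n+1]*nCk (suc n) zero =
  trans (+-identityʳ _) (trans (nC1≡n (suc (suc n))) (sym (*-identityʳ (suc (suc n)))))
[k+1]*[n+1]C[k+1]≡[n+1]*nCk (suc n) (suc k) = begin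
  (2 ℕ.+ k) ℕ.* (suc (suc n) C suc (suc k))
    ≡⟨ cong ((2 ℕ.+ k) ℕ.*_) (nCk+nC[k+1]≡[n+1]C[k+1] (suc n) (suc k)) ⟨
  (2 ℕ.+ k) ℕ.* (a ℕ.+ b)
    ≡⟨ split a b k ⟩
  a ℕ.+ ((1 ℕ.+ k) ℕ.* a ℕ.+ (2 ℕ.+ k) ℕ.* b)
    ≡⟨ cong₂ (λ x y → a ℕ.+ (x ℕ.+ y)) ([k+1]*[n+1]C[k+1]≡[n+1]*nCk n k)
                                        ([k+1]*[n+1]C[k+1]≡[n+1]*nCk n (suc k)) ⟩
  a ℕ.+ (suc n ℕ.* (n C k) ℕ.+ suc n ℕ.* (n C suc k))
    ≡⟨ cong (a ℕ.+_) (*-distribˡ-+ (suc n) (n C k) (n C suc k)) ⟨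
  a ℕ.+ suc n ℕ.* (n C k ℕ.+ n C suc k)
    ≡⟨ cong (λ x → a ℕ.+ suc n ℕ.* x) (nCk+nC[k+1]≡[n+1]C[k+1] n k) ⟩
  a ℕ.+ suc n ℕ.* a ∎
  where
  open ≡-Reasoning
  a = suc n C suc k
  b = suc n C suc (suc k)
  split : ∀ a b k → (2 ℕ.+ k) ℕ.* (a ℕ.+ b) ≡ a ℕ.+ ((1 ℕ.+ k) ℕ.* a ℕ.+ (2 ℕ.+ k) ℕ.* b)
  split = solve-∀

prime∣pCk : ∀ {p k} → Prime p → 0 < k → k < p → p ∣ p C k
prime∣pCk {suc n} {suc k} p-prime _ k<p
  with euclidsLemma (suc k) (suc n C suc k) p-prime
         (divides (n C k) (trans ([k+1]*[n+1]C[k+1]≡[n+1]*nCk n k) (*-comm (suc n) (n C k))))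
... | inj₁ p∣k   = contradiction (∣⇒≤ p∣k) (<⇒≱ k<p)
... | inj₂ p∣pCk = p∣pCk

-- A record rather than a synonym for  + p ∣ a - b,  so that a and b stay inferable.
infix 4 _≡_mod_
record _≡_mod_ (a b : ℤ) (p : ℕ) : Set where
  constructor ≡-mod
  field difference-divisible : + p ℤ∣.∣ a - b

module _ {p : ℕ} where

  ≡-mod-refl : ∀ {a} → a ≡ a mod p
  ≡-mod-refl {a} = ≡-mod (ℤ∣.divides 0ℤ (ℤ.+-inverseʳ a))

  ≡-mod-trans : ∀ {a b c} → a ≡ b mod p → b ≡ c mod p → a ≡ c mod p
  ≡-mod-trans {a} {b} {c} (≡-mod p∣a-b) (≡-mod p∣b-c) =
    ≡-mod (subst (+ p ℤ∣.∣_) (telescope a b c) (ℤ∣.∣m∣n⇒∣m+n p∣a-b p∣b-c))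
    where
    telescope : ∀ a b c → (a - b) + (b - c) ≡ a - c
    telescope = ℤ-Solver.solve-∀

  +-cong-mod : ∀ {a b c d} → a ≡ b mod p → c ≡ d mod p → a + c ≡ b + d mod p
  +-cong-mod {a} {b} {c} {d} (≡-mod p∣a-b) (≡-mod p∣c-d) =
    ≡-mod (subst (+ p ℤ∣.∣_) (regroup a b c d) (ℤ∣.∣m∣n⇒∣m+n p∣a-b p∣c-d))
    where
    regroup : ∀ a b c d → (a - b) + (c - d) ≡ (a + c) - (b + d)
    regroup = ℤ-Solver.solve-∀

  neg-cong-mod : ∀ {a b} → a ≡ b mod p → - a ≡ - b mod p
  neg-cong-mod {a} {b} (≡-mod p∣a-b) =
    ≡-mod (subst (+ p ℤ∣.∣_) (negate a b) (ℤ∣.∣m⇒∣-m p∣a-b))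
    where
    negate : ∀ a b → - (a - b) ≡ - a - - b
    negate = ℤ-Solver.solve-∀

  ∣⇒≡0-mod : ∀ {a} → + p ℤ∣.∣ a → a ≡ 0ℤ mod p
  ∣⇒≡0-mod {a} = ≡-mod ∘ subst (+ p ℤ∣.∣_) (sym (ℤ.+-identityʳ a))

  ≡0-mod⇒∣ : ∀ {a} → + a ≡ 0ℤ mod p → p ∣ a
  ≡0-mod⇒∣ {a} (≡-mod p∣a) = subst (p ∣_) (+-identityʳ a) (∣⇒∣ᵤ p∣a)

  module ≡-mod-Reasoning = SingleRelationReasoning (λ a b → a ≡ b mod p) ≡-mod-refl ≡-mod-trans

opposite-◃ : ∀ s n → opposite s ◃ n ≡ - (s ◃ n)
opposite-◃ _      zero    = refl
opposite-◃ Sign.+ (suc n) = refl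
opposite-◃ Sign.- (suc n) = refl

◃-distrib-+ : ∀ s m n → s ◃ (m ℕ.+ n) ≡ (s ◃ m) + (s ◃ n)
◃-distrib-+ Sign.+ m n
  rewrite ℤ.+◃n≡+n (m ℕ.+ n) | ℤ.+◃n≡+n m | ℤ.+◃n≡+n n = ℤ.pos-+ m n
◃-distrib-+ Sign.- m n
  rewrite ℤ.-◃n≡-n (m ℕ.+ n) | ℤ.-◃n≡-n m | ℤ.-◃n≡-n n =
  trans (cong -_ (ℤ.pos-+ m n)) (ℤ.neg-distrib-+ (+ m) (+ n))

◃-cong-mod : ∀ {p c t} s → + c ≡ t ◃ 1 mod p → s ◃ c ≡ (s Sign.* t) ◃ 1 mod p
◃-cong-mod {c = c} Sign.+ c≡t = subst (_≡ _ mod _) (sym (ℤ.+◃n≡+n c)) c≡t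
◃-cong-mod {c = c} {t} Sign.- c≡t =
  subst₂ (_≡_mod _) (sym (ℤ.-◃n≡-n c)) (sym (opposite-◃ t 1)) (neg-cong-mod c≡t)

binom≡altSign : ∀ {n i} → Prime (suc n) → i ≤ n → + (n C i) ≡ altSign i ◃ 1 mod suc n
binom≡altSign {i = zero} _ _ = ≡-mod-refl
binom≡altSign {n} {suc i} p-prime i<n = begin
  + (n C suc i)
    ≡⟨ pascal ⟩
  + (suc n C suc i) - + (n C i)
    ∼⟨ +-cong-mod (∣⇒≡0-mod p∣[n+1]C[i+1]) (neg-cong-mod (binom≡altSign p-prime (<⇒≤ i<n))) ⟩
  0ℤ - (altSign i ◃ 1)
    ≡⟨ trans (ℤ.+-identityˡ _) (sym (opposite-◃ (altSign i) 1)) ⟩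
  altSign (suc i) ◃ 1 ∎
  where
  open ≡-mod-Reasoning
  p∣[n+1]C[i+1] : + suc n ℤ∣.∣ + (suc n C suc i)
  p∣[n+1]C[i+1] = ∣ᵤ⇒∣ (prime∣pCk p-prime (s≤s z≤n) (s≤s i<n))
  b≡[a+b]-a : ∀ a b → b ≡ (a + b) - a
  b≡[a+b]-a = ℤ-Solver.solve-∀
  pascal : + (n C suc i) ≡ + (suc n C suc i) - + (n C i)
  pascal = trans (b≡[a+b]-a (+ (n C i)) (+ (n C suc i)))
                 (cong (_- + (n C i)) (trans (sym (ℤ.pos-+ (n C i) (n C suc i)))
                                             (cong +_ (nCk+nC[k+1]≡[n+1]C[k+1] n i))))

module _ {a} {A : Set a} (_≟_ : DecidableEquality A) where

  hammingDistance : ∀ {m} → Vec A m → Vec A m → ℕ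
  hammingDistance []       []       = 0
  hammingDistance (x ∷ xs) (y ∷ ys) = (if does (x ≟ y) then 0 else 1) ℕ.+ hammingDistance xs ys

  hammingDistance≤length : ∀ {m} (xs ys : Vec A m) → hammingDistance xs ys ≤ m
  hammingDistance≤length []       []       = z≤n
  hammingDistance≤length (x ∷ xs) (y ∷ ys) with x ≟ y
  ... | yes _ = m≤n⇒m≤1+n (hammingDistance≤length xs ys)
  ... | no _  = s≤s (hammingDistance≤length xs ys)

  hammingDistance≡0⇒≡ : ∀ {m} (xs ys : Vec A m) → hammingDistance xs ys ≡ 0 → xs ≡ ys
  hammingDistance≡0⇒≡ []       []       _ = refl
  hammingDistance≡0⇒≡ (x ∷ xs) (y ∷ ys) d≡0 with x ≟ y
  ... | yes x≡y = cong₂ _∷_ x≡y (hammingDistance≡0⇒≡ xs ys d≡0)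

≢⇒≡opposite : ∀ {s t} → s ≢ t → s ≡ opposite t
≢⇒≡opposite {Sign.+} {Sign.+} s≢t = contradiction refl s≢t
≢⇒≡opposite {Sign.+} {Sign.-} _   = refl
≢⇒≡opposite {Sign.-} {Sign.+} _   = refl
≢⇒≡opposite {Sign.-} {Sign.-} s≢t = contradiction refl s≢t

hammingDistance≡length⇒≡map-opposite : ∀ {m} (xs ys : Vec Sign m) →
  hammingDistance Sign._≟_ xs ys ≡ m → xs ≡ map opposite ys
hammingDistance≡length⇒≡map-opposite []       []       _ = refl
hammingDistance≡length⇒≡map-opposite (x ∷ xs) (y ∷ ys) d≡m with x Sign.≟ y
... | yes _   = contradiction d≡m (<⇒≢ (s≤s (hammingDistance≤length Sign._≟_ xs ys)))
... | no x≢y = cong₂ _∷_ (≢⇒≡opposite x≢y)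
                         (hammingDistance≡length⇒≡map-opposite xs ys (suc-injective d≡m))

*◃1+2[≢]≡1 : ∀ s t → ((s Sign.* t) ◃ 1) + + (2 ℕ.* (if does (s Sign.≟ t) then 0 else 1)) ≡ 1ℤ
*◃1+2[≢]≡1 Sign.+ Sign.+ = refl
*◃1+2[≢]≡1 Sign.+ Sign.- = refl
*◃1+2[≢]≡1 Sign.- Sign.+ = refl
*◃1+2[≢]≡1 Sign.- Sign.- = refl

signedSumFrom+2*hammingDistance≡length : ∀ {n k m} → Prime (suc n) → k ℕ.+ m ≤ suc n →
  (δ : Vec Sign m) →
  signedSumFrom n k δ + + (2 ℕ.* hammingDistance Sign._≟_ δ (iterate opposite (altSign k) m))
    ≡ + m mod suc n
signedSumFrom+2*hammingDistance≡length _ _ [] = ≡-mod-refl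
signedSumFrom+2*hammingDistance≡length {n} {k} {suc m} p-prime k+m≤p (s ∷ δ) = begin
  (x + S) + + (2 ℕ.* (d ℕ.+ H))
    ≡⟨ regroup ⟩
  (x + + (2 ℕ.* d)) + (S + + (2 ℕ.* H))
    ∼⟨ +-cong-mod first-term (signedSumFrom+2*hammingDistance≡length p-prime k+m<p δ) ⟩
  + suc m ∎
  where
  open ≡-mod-Reasoning
  x = s ◃ (n C k)
  S = signedSumFrom n (suc k) δ
  d = if does (s Sign.≟ altSign k) then 0 else 1
  H = hammingDistance Sign._≟_ δ (iterate opposite (altSign (suc k)) m)
  k+m<p : suc k ℕ.+ m ≤ suc n
  k+m<p = subst (_≤ suc n) (+-suc k m) k+m≤p
  k≤n : k ≤ n
  k≤n = m+n≤o⇒m≤o k (≤-pred k+m<p)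
  first-term : x + + (2 ℕ.* d) ≡ 1ℤ mod suc n
  first-term = begin
    x + + (2 ℕ.* d)
      ∼⟨ +-cong-mod (◃-cong-mod s (binom≡altSign p-prime k≤n)) ≡-mod-refl ⟩
    ((s Sign.* altSign k) ◃ 1) + + (2 ℕ.* d)
      ≡⟨ *◃1+2[≢]≡1 s (altSign k) ⟩
    1ℤ ∎
  interchange : ∀ a b c d → (a + b) + (c + d) ≡ (a + c) + (b + d)
  interchange = ℤ-Solver.solve-∀
  regroup : (x + S) + + (2 ℕ.* (d ℕ.+ H)) ≡ (x + + (2 ℕ.* d)) + (S + + (2 ℕ.* H))
  regroup = trans (cong (_+_ (x + S)) (trans (cong +_ (*-distribˡ-+ 2 d H)) (ℤ.pos-+ (2 ℕ.* d) (2 ℕ.* H))))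
                  (interchange x S (+ (2 ℕ.* d)) (+ (2 ℕ.* H)))

map-iterate : ∀ {a} {A : Set a} (f : A → A) x m → map f (iterate f x m) ≡ iterate f (f x) m
map-iterate f x zero    = refl
map-iterate f x (suc m) = cong (f x ∷_) (map-iterate f (f x) m)

∣∧≤⇒≡0⊎≡ : ∀ {p m} → p ∣ m → m ≤ p → m ≡ 0 ⊎ m ≡ p
∣∧≤⇒≡0⊎≡ {m = zero}  _   _   = inj₁ refl
∣∧≤⇒≡0⊎≡ {m = suc _} p∣m m≤p = inj₂ (≤-antisym m≤p (∣⇒≤ p∣m))

zeroSum⇒alternating : ∀ {n} → Prime (suc n) → (δ : SignVec n) → signedBinomSum n δ ≡ 0ℤ →
  δ ≡ iterate opposite Sign.+ (suc n) ⊎ δ ≡ iterate opposite Sign.- (suc n)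
-- For p = 2 the congruence p ∣ 2H carries no information.
zeroSum⇒alternating {1} _ (Sign.+ ∷ Sign.+ ∷ []) ()
zeroSum⇒alternating {1} _ (Sign.+ ∷ Sign.- ∷ []) _ = inj₁ refl
zeroSum⇒alternating {1} _ (Sign.- ∷ Sign.+ ∷ []) _ = inj₂ refl
zeroSum⇒alternating {1} _ (Sign.- ∷ Sign.- ∷ []) ()
zeroSum⇒alternating {suc (suc n)} p-prime δ sum≡0
  with ∣∧≤⇒≡0⊎≡ p∣H (hammingDistance≤length Sign._≟_ δ α)
  where
  p = suc (suc (suc n))
  α = iterate opposite Sign.+ p
  H = hammingDistance Sign._≟_ δ α
  2H≡p : + (2 ℕ.* H) ≡ + p mod p
  2H≡p = subst (λ S → S + + (2 ℕ.* H) ≡ + p mod p) sum≡0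
           (signedSumFrom+2*hammingDistance≡length p-prime ≤-refl δ)
  p∣2H : p ∣ 2 ℕ.* H
  p∣2H = ≡0-mod⇒∣ (≡-mod-trans 2H≡p (∣⇒≡0-mod ℤ∣.∣-refl))
  p∣H : p ∣ H
  p∣H with euclidsLemma 2 H p-prime p∣2H
  ... | inj₁ p∣2 = contradiction (∣⇒≤ p∣2) (<⇒≱ (s≤s (s≤s (s≤s z≤n))))
  ... | inj₂ p∣H = p∣H
... | inj₁ H≡0 = inj₁ (hammingDistance≡0⇒≡ Sign._≟_ δ _ H≡0)
... | inj₂ H≡p =
  inj₂ (trans (hammingDistance≡length⇒≡map-opposite δ _ H≡p) (map-iterate opposite Sign.+ _))

signedSumFrom-alternating : ∀ {n k m} t → k ℕ.+ m ≡ suc n →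
  signedSumFrom (suc n) (suc k) (iterate opposite t m) ≡ t ◃ (n C k)
signedSumFrom-alternating {n} {k} {zero} t k+0≡n+1 =
  cong (t ◃_) (sym (k>n⇒nCk≡0 (≤-reflexive (trans (sym k+0≡n+1) (+-identityʳ k)))))
signedSumFrom-alternating {n} {k} {suc m} t k+m≡n+1 = begin
  (t ◃ (suc n C suc k)) + signedSumFrom (suc n) (suc (suc k)) (iterate opposite (opposite t) m)
    ≡⟨ cong₂ _+_ (cong (t ◃_) (sym (nCk+nC[k+1]≡[n+1]C[k+1] n k)))
                 (signedSumFrom-alternating {k = suc k} {m} (opposite t) (trans (sym (+-suc k m)) k+m≡n+1)) ⟩
  (t ◃ (n C k ℕ.+ n C suc k)) + (opposite t ◃ (n C suc k))
    ≡⟨ cong₂ _+_ (◃-distrib-+ t (n C k) (n C suc k)) (opposite-◃ t (n C suc k)) ⟩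
  ((t ◃ (n C k)) + (t ◃ (n C suc k))) + - (t ◃ (n C suc k))
    ≡⟨ [a+b]-b≡a (t ◃ (n C k)) (t ◃ (n C suc k)) ⟩
  t ◃ (n C k) ∎
  where
  open ≡-Reasoning
  [a+b]-b≡a : ∀ a b → (a + b) + - b ≡ a
  [a+b]-b≡a = ℤ-Solver.solve-∀

signedBinomSum-alternating≡0 : ∀ n t → signedBinomSum (suc n) (iterate opposite t (suc (suc n))) ≡ 0ℤ
signedBinomSum-alternating≡0 n t = begin
  (t ◃ 1) + signedSumFrom (suc n) 1 (iterate opposite (opposite t) (suc n))
    ≡⟨ cong (_+_ (t ◃ 1)) (signedSumFrom-alternating {k = 0} {suc n} (opposite t) refl) ⟩
  (t ◃ 1) + (opposite t ◃ 1)
    ≡⟨ cong (_+_ (t ◃ 1)) (opposite-◃ t 1) ⟩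
  (t ◃ 1) - (t ◃ 1)
    ≡⟨ ℤ.+-inverseʳ (t ◃ 1) ⟩
  0ℤ ∎
  where open ≡-Reasoning

zeroSum⇔alternating : ∀ {n} → Prime (suc n) → (δ : SignVec n) →
  signedBinomSum n δ ≡ 0ℤ ⇔ (δ ≡ iterate opposite Sign.+ (suc n) ⊎ δ ≡ iterate opposite Sign.- (suc n))
zeroSum⇔alternating {suc n} p-prime δ = mk⇔ (zeroSum⇒alternating p-prime δ) λ where
  (inj₁ refl) → signedBinomSum-alternating≡0 n Sign.+
  (inj₂ refl) → signedBinomSum-alternating≡0 n Sign.-

lookup-ext : ∀ {a} {A : Set a} {m} {xs ys : Vec A m} → (∀ i → lookup xs i ≡ lookup ys i) → xs ≡ ys
lookup-ext {xs = xs} {ys} xs≗ys =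
  trans (sym (tabulate∘lookup xs)) (trans (tabulate-cong xs≗ys) (tabulate∘lookup ys))

opposite[s]*t≡s*opposite[t] : ∀ s t → opposite s Sign.* t ≡ s Sign.* opposite t
opposite[s]*t≡s*opposite[t] Sign.+ t = refl
opposite[s]*t≡s*opposite[t] Sign.- t = sym (Sign.opposite-involutive t)

lookup-alternating : ∀ {m} t (i : Fin m) → lookup (iterate opposite t m) i ≡ t Sign.* altSign (toℕ i)
lookup-alternating t zero    = sym (Sign.*-identityʳ t)
lookup-alternating t (suc i) = trans (lookup-alternating (opposite t) i) (opposite[s]*t≡s*opposite[t] t _)

≡alternating⇔pointwise : ∀ {m} t (δ : Vec Sign m) →
  δ ≡ iterate opposite t m ⇔ (∀ i → lookup δ i ≡ t Sign.* altSign (toℕ i))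
≡alternating⇔pointwise t δ = mk⇔
  (λ { refl → lookup-alternating t })
  (λ δ≗alt → lookup-ext (λ i → trans (δ≗alt i) (sym (lookup-alternating t i))))

module _ {a p q r} {A : Set a} {P : Pred A p} {Q : Pred A q} {R : Pred A r}
         (P? : Decidable P) (Q? : Decidable Q) (R? : Decidable R) where

  length-filter-⊎ : (∀ {x} → P x ⇔ (Q x ⊎ R x)) → (∀ {x} → Q x → ¬ R x) → ∀ xs →
    length (filter P? xs) ≡ length (filter Q? xs) ℕ.+ length (filter R? xs)
  length-filter-⊎ P⇔Q⊎R Q⇒¬R [] = refl
  length-filter-⊎ P⇔Q⊎R Q⇒¬R (x ∷ xs) with Q? x | R? x
  ... | yes qx | yes rx = contradiction rx (Q⇒¬R qx)
  ... | yes qx | no _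
    rewrite filter-accept P? {xs = xs} (Equivalence.from P⇔Q⊎R (inj₁ qx)) =
    cong suc (length-filter-⊎ P⇔Q⊎R Q⇒¬R xs)
  ... | no _   | yes rx
    rewrite filter-accept P? {xs = xs} (Equivalence.from P⇔Q⊎R (inj₂ rx)) =
    trans (cong suc (length-filter-⊎ P⇔Q⊎R Q⇒¬R xs)) (sym (+-suc _ _))
  ... | no ¬qx | no ¬rx
    rewrite filter-reject P? {xs = xs} ([ ¬qx , ¬rx ] ∘ Equivalence.to P⇔Q⊎R) =
    length-filter-⊎ P⇔Q⊎R Q⇒¬R xs

_≟ᵥ_ : ∀ {m} → DecidableEquality (Vec Sign m)
_≟ᵥ_ = ≡-dec Sign._≟_

module _ {m : ℕ} where

  length-filter-concatMap : ∀ {p} {P : Pred (Vec Sign (suc m)) p} (P? : Decidable P) (vs : List (Vec Sign m)) →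
    length (filter P? (concatMap (λ v → (Sign.+ ∷ v) ∷ (Sign.- ∷ v) ∷ []) vs))
      ≡ length (filter (P? ∘ (Sign.+ ∷_)) vs) ℕ.+ length (filter (P? ∘ (Sign.- ∷_)) vs)
  length-filter-concatMap P? []       = refl
  length-filter-concatMap P? (v ∷ vs) with does (P? (Sign.+ ∷ v))
  ... | true  with does (P? (Sign.- ∷ v))
  ...   | true  = cong suc (trans (cong suc (length-filter-concatMap P? vs)) (sym (+-suc _ _)))
  ...   | false = cong suc (length-filter-concatMap P? vs)
  length-filter-concatMap P? (v ∷ vs) | false with does (P? (Sign.- ∷ v))
  ...   | true  = trans (cong suc (length-filter-concatMap P? vs)) (sym (+-suc _ _))
  ...   | false = length-filter-concatMap P? vs

  length-filter-≟-∷ : ∀ s (v : Vec Sign m) vs →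
    length (filter (λ w → (s ∷ w) ≟ᵥ (s ∷ v)) vs) ≡ length (filter (_≟ᵥ v) vs)
  length-filter-≟-∷ s v vs = cong length (filter-≐ _ _ (∷-injectiveʳ , cong (s ∷_)) vs)

  length-filter-≟-∷-≢ : ∀ s t → s ≢ t → ∀ (v : Vec Sign m) vs →
    length (filter (λ w → (t ∷ w) ≟ᵥ (s ∷ v)) vs) ≡ 0
  length-filter-≟-∷-≢ s t s≢t v vs =
    cong length (filter-none _ (All.universal (λ _ → s≢t ∘ sym ∘ ∷-injectiveˡ) vs))

allSignVecs-unique : ∀ {m} (v : Vec Sign m) → length (filter (_≟ᵥ v) (allSignVecs m)) ≡ 1
allSignVecs-unique []                   = refl
allSignVecs-unique {suc m} (Sign.+ ∷ v) =
  trans (length-filter-concatMap (_≟ᵥ (Sign.+ ∷ v)) (allSignVecs m))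
        (cong₂ ℕ._+_ (trans (length-filter-≟-∷ Sign.+ v (allSignVecs m)) (allSignVecs-unique v))
                     (length-filter-≟-∷-≢ Sign.+ Sign.- (λ ()) v (allSignVecs m)))
allSignVecs-unique {suc m} (Sign.- ∷ v) =
  trans (length-filter-concatMap (_≟ᵥ (Sign.- ∷ v)) (allSignVecs m))
        (cong₂ ℕ._+_ (length-filter-≟-∷-≢ Sign.- Sign.+ (λ ()) v (allSignVecs m))
                     (trans (length-filter-≟-∷ Sign.- v (allSignVecs m)) (allSignVecs-unique v)))

J≡2 : ∀ {n} → Prime (suc n) → J n ≡ 2
J≡2 {n} p-prime = trans
  (length-filter-⊎ (λ δ → signedBinomSum n δ ℤ.≟ 0ℤ) (_≟ᵥ α₊) (_≟ᵥ α₋)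
                   (zeroSum⇔alternating p-prime _) α₊≢α₋ (allSignVecs (suc n)))
  (cong₂ ℕ._+_ (allSignVecs-unique α₊) (allSignVecs-unique α₋))
  where
  α₊ α₋ : SignVec n
  α₊ = iterate opposite Sign.+ (suc n)
  α₋ = iterate opposite Sign.- (suc n)
  α₊≢α₋ : ∀ {δ} → δ ≡ α₊ → δ ≢ α₋
  α₊≢α₋ refl α₊≡α₋ = contradiction (∷-injectiveˡ α₊≡α₋) λ ()

theorem8 : (p : ℕ) → Prime p →
    (J (p ∸ 1) ≡ 2)
    × ((δ : SignVec (p ∸ 1)) →
        (signedBinomSum (p ∸ 1) δ ≡ 0ℤ)
          ⇔ (((i : _) → lookup δ i ≡ altSign (toℕ i))
             ⊎ ((i : _) → lookup δ i ≡ opposite (altSign (toℕ i)))))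
theorem8 (suc n) p-prime = J≡2 p-prime , λ δ →
  (≡alternating⇔pointwise Sign.+ δ ⊎-⇔ ≡alternating⇔pointwise Sign.- δ)
    ⇔-∘ zeroSum⇔alternating p-prime δ
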